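{- For every code $C\subseteq\{0,1\}^r$ and every $\alpha\in(0,1]$, $N(\alpha;\mathcal{C})=\mathrm{NRD}(C)+1$, where $\mathcal{C}=\{C_1,\dots,C_r\}$ is the family of diagonal positive semidefinite matrices $C_i\in\mathbb{R}^{C\times C}$ (rows and columns indexed by the codewords of $C$) with diagonal entries $C_i(c,c)=c_i$ for $c\in C$.
   Context: A code is any (possibly non-linear) nonempty subset $C\subseteq\{0,1\}^r$. The family $\mathcal{C}$ is indexed by $[r]=\{1,\dots,r\}$ (repetitions allowed). $A\preceq B$ means $B-A$ is positive semidefinite (PSD). Connectivity parameter: for a family $\mathcal{A}=\{A_1,\dots,A_r\}$ of PSD matrices and $\alpha\ge0$, $N(\alpha;\mathcal{A})$ is the smallest integer such that for every $T\subseteq[r]$ with $|T|\ge N(\alpha;\mathcal{A})$ there exists $i\in T$ with $\alpha A_i\preceq\sum_{j\in T\setminus\{i\}}A_j$; if no such integer (at most $r$) exists, $N(\alpha;\mathcal{A})=r+1$. Non-redundancy: $\mathrm{NRD}(C)$ is the largest integer $k$ such that there exist an index set $I\subseteq[r]$ with $|I|=k$ and codewords $c^{(j)}\in C$, one for each $j\in I$, such that for all $i,j\in I$, $c^{(j)}_i=1$ if $i=j$ and $c^{(j)}_i=0$ if $i\ne j$. -}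

module Defs where

open import Algebra.Bundles.Raw using (RawMonoid)
import Algebra.Definitions.RawMonoid as RawMonoidDefs
open import Data.Bool.Base using (Bool; true; false; T; if_then_else_)
open import Data.Bool.Properties using (T?) renaming (_≟_ to _≟ᵇ_)
open import Data.Empty using (⊥-elim)
open import Data.Fin.Base using (Fin; zero; suc)
import Data.Fin.Properties as Fin
open import Data.Fin.Subset using (Subset; _∈_; ∣_∣; _-_)
open import Data.Fin.Subset.Properties using (_∈?_; anySubset?; ∣p∣≤n; ∉⊥; ∣⊥∣≡0)
import Data.Fin.Subset as Subset
open import Data.List.Base using (List; []; _∷_; length; filter; cartesianProductWith)
import Data.List.Base as List
open import Data.List.Membership.Propositional using (find; lose) renaming (_∈_ to _∈ˡ_)
open import Data.List.Membership.Propositional.Properties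
  using (∈-filter⁺; ∈-filter⁻; ∈-cartesianProductWith⁺)
open import Data.List.Relation.Unary.All using ([]; _∷_)
open import Data.List.Relation.Unary.Any using (here; there; any?)
open import Data.List.Relation.Unary.AllPairs using ([]; _∷_)
open import Data.List.Relation.Unary.Unique.Propositional using (Unique)
open import Data.List.Relation.Unary.Unique.Propositional.Properties
  using (filter⁺; cartesianProductWith⁺)
open import Data.Nat.Base as ℕ using (ℕ; zero; suc)
import Data.Nat.Properties as ℕ
open import Data.Product.Base using (Σ; ∃; ∃-syntax; _×_; _,_; proj₁; proj₂)
open import Data.Rational.Base as ℚ using (ℚ; 0ℚ; 1ℚ; ½)
import Data.Rational.Properties as ℚ
open import Data.Rational.Solver using (module +-*-Solver)
open import Data.Sum.Base using (_⊎_; inj₁; inj₂)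
open import Data.Vec.Base as Vec using (Vec; []; _∷_; lookup)
open import Data.Vec.Properties using (∷-injective)
open import Function.Base using (_∘_)
open import Level using (0ℓ)
open import Relation.Binary.PropositionalEquality
  using (_≡_; _≢_; refl; sym; trans; cong; cong₂; subst)
open import Relation.Nullary using (¬_; Dec; yes; no; does)
open import Relation.Nullary.Decidable using (map′; ¬?; _×-dec_; _→-dec_)
open import Relation.Unary using (Pred; Decidable)

-- Constructive Cauchy reals; classically a model of ℝ.  Arithmetic is termwise on
-- the sequences, and equality of reals is _≃_, not _≡_.

IsCauchy : (ℕ → ℚ) → Set
IsCauchy f = ∀ ε → 0ℚ ℚ.< ε → ∃[ N ] (∀ m n → N ℕ.≤ m → N ℕ.≤ n →
             ℚ.∣ f m ℚ.- f n ∣ ℚ.< ε)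

record ℝ : Set where
  constructor mkℝ
  field
    seq    : ℕ → ℚ
    cauchy : IsCauchy seq

open ℝ public

infix 4 _≃_ _≤_ _<_

_≃_ : ℝ → ℝ → Set
x ≃ y = ∀ ε → 0ℚ ℚ.< ε → ∃[ N ] (∀ n → N ℕ.≤ n → ℚ.∣ seq x n ℚ.- seq y n ∣ ℚ.< ε)

_≤_ : ℝ → ℝ → Set
x ≤ y = ∀ ε → 0ℚ ℚ.< ε → ∃[ N ] (∀ n → N ℕ.≤ n → seq x n ℚ.≤ seq y n ℚ.+ ε)

_<_ : ℝ → ℝ → Set
x < y = ∃[ ε ] (0ℚ ℚ.< ε × ∃[ N ] (∀ n → N ℕ.≤ n → seq x n ℚ.+ ε ℚ.≤ seq y n))

-- Only the moduli of sums and products depend on these proofs.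

abstract
  0<½* : ∀ {ε} → 0ℚ ℚ.< ε → 0ℚ ℚ.< ½ ℚ.* ε
  0<½* {ε} 0<ε = subst (ℚ._< ½ ℚ.* ε) (ℚ.*-zeroʳ ½) (ℚ.*-monoʳ-<-pos ½ 0<ε)

  ½+½ : ∀ ε → ½ ℚ.* ε ℚ.+ ½ ℚ.* ε ≡ ε
  ½+½ ε = trans (sym (ℚ.*-distribʳ-+ ε ½ ½)) (ℚ.*-identityˡ ε)

  +-cauchy : ∀ {f g} → IsCauchy f → IsCauchy g → IsCauchy (λ n → f n ℚ.+ g n)
  +-cauchy {f} {g} cf cg ε 0<ε with cf (½ ℚ.* ε) (0<½* 0<ε) | cg (½ ℚ.* ε) (0<½* 0<ε)
  ... | M , hf | N , hg = M ℕ.⊔ N , λ m n m≥ n≥ → begin-strict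
      ℚ.∣ (f m ℚ.+ g m) ℚ.- (f n ℚ.+ g n) ∣
        ≡⟨ cong ℚ.∣_∣ (solve 4 (λ a b c d → (a :+ b) :- (c :+ d) := (a :- c) :+ (b :- d)) refl
             (f m) (g m) (f n) (g n)) ⟩
      ℚ.∣ (f m ℚ.- f n) ℚ.+ (g m ℚ.- g n) ∣
        ≤⟨ ℚ.∣p+q∣≤∣p∣+∣q∣ (f m ℚ.- f n) (g m ℚ.- g n) ⟩
      ℚ.∣ f m ℚ.- f n ∣ ℚ.+ ℚ.∣ g m ℚ.- g n ∣
        <⟨ ℚ.+-mono-< (hf m n (ℕ.m⊔n≤o⇒m≤o M N m≥) (ℕ.m⊔n≤o⇒m≤o M N n≥))
                      (hg m n (ℕ.m⊔n≤o⇒n≤o M N m≥) (ℕ.m⊔n≤o⇒n≤o M N n≥)) ⟩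
      ½ ℚ.* ε ℚ.+ ½ ℚ.* ε ≡⟨ ½+½ ε ⟩
      ε ∎
    where open ℚ.≤-Reasoning
          open +-*-Solver

  neg-cauchy : ∀ {f} → IsCauchy f → IsCauchy (λ n → ℚ.- f n)
  neg-cauchy {f} cf ε 0<ε with cf ε 0<ε
  ... | N , hf = N , λ m n m≥ n≥ → subst (ℚ._< ε) (eq m n) (hf m n m≥ n≥)
    where
      open +-*-Solver
      eq : ∀ m n → ℚ.∣ f m ℚ.- f n ∣ ≡ ℚ.∣ (ℚ.- f m) ℚ.- (ℚ.- f n) ∣
      eq m n = trans (sym (ℚ.∣-p∣≡∣p∣ (f m ℚ.- f n)))
        (cong ℚ.∣_∣ (solve 2 (λ a b → :- (a :- b) := (:- a) :- (:- b)) refl (f m) (f n)))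

  eventually-bounded : ∀ {f} → IsCauchy f →
    ∃[ B ] (0ℚ ℚ.< B × ∃[ N ] (∀ n → N ℕ.≤ n → ℚ.∣ f n ∣ ℚ.≤ B))
  eventually-bounded {f} cf with cf 1ℚ (ℚ.positive⁻¹ 1ℚ)
  ... | N , h = 1ℚ ℚ.+ ℚ.∣ f N ∣ ,
      ℚ.+-mono-<-≤ (ℚ.positive⁻¹ 1ℚ) (ℚ.0≤∣p∣ (f N)) , N , λ n n≥ → begin
      ℚ.∣ f n ∣ ≡⟨ cong ℚ.∣_∣ (solve 2 (λ a b → a := (a :- b) :+ b) refl (f n) (f N)) ⟩
      ℚ.∣ (f n ℚ.- f N) ℚ.+ f N ∣ ≤⟨ ℚ.∣p+q∣≤∣p∣+∣q∣ (f n ℚ.- f N) (f N) ⟩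
      ℚ.∣ f n ℚ.- f N ∣ ℚ.+ ℚ.∣ f N ∣ ≤⟨ ℚ.+-monoˡ-≤ ℚ.∣ f N ∣ (ℚ.<⇒≤ (h n N n≥ ℕ.≤-refl)) ⟩
      1ℚ ℚ.+ ℚ.∣ f N ∣ ∎
    where open ℚ.≤-Reasoning
          open +-*-Solver

  small-multiple : ∀ {B ε} → 0ℚ ℚ.< B → 0ℚ ℚ.< ε → ∃[ δ ] (0ℚ ℚ.< δ × B ℚ.* δ ≡ ½ ℚ.* ε)
  small-multiple {B} {ε} 0<B 0<ε =
      (ℚ.1/ B) ℚ.* (½ ℚ.* ε)
    , ℚ.positive⁻¹ _ {{ℚ.pos*pos⇒pos (ℚ.1/ B) {{ℚ.1/pos⇒pos B}} (½ ℚ.* ε) {{ℚ.positive (0<½* 0<ε)}}}}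
    , trans (sym (ℚ.*-assoc B (ℚ.1/ B) (½ ℚ.* ε)))
        (trans (cong (ℚ._* (½ ℚ.* ε)) (ℚ.*-inverseʳ B)) (ℚ.*-identityˡ (½ ℚ.* ε)))
    where
      instance
        B-pos : ℚ.Positive B
        B-pos = ℚ.positive 0<B
        B-nz : ℚ.NonZero B
        B-nz = ℚ.pos⇒nonZero B

  ∣p*q∣<A*δ : ∀ {p q A δ} → 0ℚ ℚ.< A → ℚ.∣ p ∣ ℚ.≤ A → ℚ.∣ q ∣ ℚ.< δ →
              ℚ.∣ p ℚ.* q ∣ ℚ.< A ℚ.* δ
  ∣p*q∣<A*δ {p} {q} {A} {δ} 0<A p≤A q<δ = begin-strict
      ℚ.∣ p ℚ.* q ∣ ≡⟨ ℚ.∣p*q∣≡∣p∣*∣q∣ p q ⟩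
      ℚ.∣ p ∣ ℚ.* ℚ.∣ q ∣ ≤⟨ ℚ.*-monoʳ-≤-nonNeg ℚ.∣ q ∣ {{ℚ.∣-∣-nonNeg q}} p≤A ⟩
      A ℚ.* ℚ.∣ q ∣ <⟨ ℚ.*-monoʳ-<-pos A {{ℚ.positive 0<A}} q<δ ⟩
      A ℚ.* δ ∎
    where open ℚ.≤-Reasoning

  *-difference : ∀ a b c d →
    a ℚ.* b ℚ.- c ℚ.* d ≡ a ℚ.* (b ℚ.- d) ℚ.+ d ℚ.* (a ℚ.- c)
  *-difference = solve 4 (λ a b c d → a :* b :- c :* d := a :* (b :- d) :+ d :* (a :- c)) refl
    where open +-*-Solver

  *-estimate : ∀ {A B δ η ε} a b c d → 0ℚ ℚ.< A → 0ℚ ℚ.< B →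
    A ℚ.* δ ≡ ½ ℚ.* ε → B ℚ.* η ≡ ½ ℚ.* ε →
    ℚ.∣ a ∣ ℚ.≤ A → ℚ.∣ d ∣ ℚ.≤ B → ℚ.∣ b ℚ.- d ∣ ℚ.< δ → ℚ.∣ a ℚ.- c ∣ ℚ.< η →
    ℚ.∣ a ℚ.* b ℚ.- c ℚ.* d ∣ ℚ.< ε
  *-estimate {A} {B} {δ} {η} {ε} a b c d 0<A 0<B Aδ≡ Bη≡ a≤A d≤B b-d<δ a-c<η = begin-strict
      ℚ.∣ a ℚ.* b ℚ.- c ℚ.* d ∣
        ≡⟨ cong ℚ.∣_∣ (*-difference a b c d) ⟩
      ℚ.∣ a ℚ.* (b ℚ.- d) ℚ.+ d ℚ.* (a ℚ.- c) ∣
        ≤⟨ ℚ.∣p+q∣≤∣p∣+∣q∣ (a ℚ.* (b ℚ.- d)) (d ℚ.* (a ℚ.- c)) ⟩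
      ℚ.∣ a ℚ.* (b ℚ.- d) ∣ ℚ.+ ℚ.∣ d ℚ.* (a ℚ.- c) ∣
        <⟨ ℚ.+-mono-< (∣p*q∣<A*δ 0<A a≤A b-d<δ) (∣p*q∣<A*δ 0<B d≤B a-c<η) ⟩
      A ℚ.* δ ℚ.+ B ℚ.* η ≡⟨ cong₂ ℚ._+_ Aδ≡ Bη≡ ⟩
      ½ ℚ.* ε ℚ.+ ½ ℚ.* ε ≡⟨ ½+½ ε ⟩
      ε ∎
    where open ℚ.≤-Reasoning

  *-cauchy : ∀ {f g} → IsCauchy f → IsCauchy g → IsCauchy (λ n → f n ℚ.* g n)
  *-cauchy {f} {g} cf cg ε 0<ε =
    let (A , 0<A , M₁ , bf) = eventually-bounded {f} cf
        (B , 0<B , M₂ , bg) = eventually-bounded {g} cg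
        (δ , 0<δ , Aδ≡)     = small-multiple 0<A 0<ε
        (η , 0<η , Bη≡)     = small-multiple 0<B 0<ε
        (M₃ , hf)           = cf η 0<η
        (M₄ , hg)           = cg δ 0<δ
        M₁₂ = M₁ ℕ.⊔ M₂
        M₃₄ = M₃ ℕ.⊔ M₄
    in M₁₂ ℕ.⊔ M₃₄ , λ m n m≥ n≥ →
       let m₁₂ = ℕ.m⊔n≤o⇒m≤o M₁₂ M₃₄ m≥
           n₁₂ = ℕ.m⊔n≤o⇒m≤o M₁₂ M₃₄ n≥
           m₃₄ = ℕ.m⊔n≤o⇒n≤o M₁₂ M₃₄ m≥
           n₃₄ = ℕ.m⊔n≤o⇒n≤o M₁₂ M₃₄ n≥
       in *-estimate (f m) (g m) (f n) (g n) 0<A 0<B Aδ≡ Bη≡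
            (bf m (ℕ.m⊔n≤o⇒m≤o M₁ M₂ m₁₂))
            (bg n (ℕ.m⊔n≤o⇒n≤o M₁ M₂ n₁₂))
            (hg m n (ℕ.m⊔n≤o⇒n≤o M₃ M₄ m₃₄) (ℕ.m⊔n≤o⇒n≤o M₃ M₄ n₃₄))
            (hf m n (ℕ.m⊔n≤o⇒m≤o M₃ M₄ m₃₄) (ℕ.m⊔n≤o⇒m≤o M₃ M₄ n₃₄))

infixl 6 _+ᴿ_ _-ᴿ_
infixl 7 _*ᴿ_

fromℚ : ℚ → ℝ
fromℚ q = mkℝ (λ _ → q) λ ε 0<ε → 0 , λ _ _ _ _ →
  subst (ℚ._< ε) (sym (cong ℚ.∣_∣ (ℚ.+-inverseʳ q))) 0<ε

0ᴿ 1ᴿ : ℝ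
0ᴿ = fromℚ 0ℚ
1ᴿ = fromℚ 1ℚ

_+ᴿ_ _-ᴿ_ _*ᴿ_ : ℝ → ℝ → ℝ
x +ᴿ y = mkℝ (λ n → seq x n ℚ.+ seq y n) (+-cauchy {seq x} {seq y} (cauchy x) (cauchy y))
x -ᴿ y = mkℝ (λ n → seq x n ℚ.+ (ℚ.- seq y n)) (+-cauchy {seq x} {λ n → ℚ.- seq y n} (cauchy x) (neg-cauchy {seq y} (cauchy y)))
x *ᴿ y = mkℝ (λ n → seq x n ℚ.* seq y n) (*-cauchy {seq x} {seq y} (cauchy x) (cauchy y))

+-rawMonoid : RawMonoid 0ℓ 0ℓ
+-rawMonoid = record { Carrier = ℝ ; _≈_ = _≃_ ; _∙_ = _+ᴿ_ ; ε = 0ᴿ }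

open RawMonoidDefs +-rawMonoid public using (sum)

Matrix : ℕ → Set
Matrix n = Fin n → Fin n → ℝ

quadraticForm : ∀ {n} → Matrix n → (Fin n → ℝ) → ℝ
quadraticForm M x = sum λ p → sum λ q → x p *ᴿ M p q *ᴿ x q

IsPSD : ∀ {n} → Matrix n → Set
IsPSD M = (∀ p q → M p q ≃ M q p) × (∀ x → 0ᴿ ≤ quadraticForm M x)

infix 4 _⪯_

_⪯_ : ∀ {n} → Matrix n → Matrix n → Set
A ⪯ B = IsPSD λ p q → B p q -ᴿ A p q

_·_ : ∀ {n} → ℝ → Matrix n → Matrix n
(α · A) p q = α *ᴿ A p q

∑[_] : ∀ {r n} → Subset r → (Fin r → Matrix n) → Matrix n
∑[ T ] A p q = sum λ j → if lookup T j then A j p q else 0ᴿ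

diagonal : ∀ {n} → (Fin n → ℝ) → Matrix n
diagonal d p q = if does (p Fin.≟ q) then d p else 0ᴿ

record PSDMatrix (n : ℕ) : Set where
  field
    matrix : Matrix n
    isPSD  : IsPSD matrix

open PSDMatrix public

IsLeast IsGreatest : Pred ℕ 0ℓ → Pred ℕ 0ℓ
IsLeast    P k = P k × (∀ m → P m → k ℕ.≤ m)
IsGreatest P k = P k × (∀ m → P m → m ℕ.≤ k)

ConnectedFrom : ∀ {r n} → ℝ → (Fin r → PSDMatrix n) → Pred ℕ 0ℓ
ConnectedFrom {r} α 𝒜 k = ∀ (T : Subset r) → k ℕ.≤ ∣ T ∣ →
  ∃[ i ] (i ∈ T × (α · matrix (𝒜 i)) ⪯ ∑[ T - i ] (matrix ∘ 𝒜))

-- "N(α; 𝒜) = k", given as a relation because positive semidefiniteness of a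
-- real matrix is not decidable constructively.  Restricting to naturals loses
-- nothing: T = ∅ contains no i, so no integer ≤ 0 has the property.

ConnectivityIs : ∀ {r n} → ℝ → (Fin r → PSDMatrix n) → Pred ℕ 0ℓ
ConnectivityIs {r} α 𝒜 k =
    (k ℕ.≤ r × IsLeast (ConnectedFrom α 𝒜) k)
  ⊎ (k ≡ r ℕ.+ 1 × (∀ m → m ℕ.≤ r → ¬ ConnectedFrom α 𝒜 m))

connectivity-unique : ∀ {r n} {α : ℝ} {𝒜 : Fin r → PSDMatrix n} {k l} →
  ConnectivityIs α 𝒜 k → ConnectivityIs α 𝒜 l → k ≡ l
connectivity-unique (inj₁ (_ , ck , mk)) (inj₁ (_ , cl , ml)) = ℕ.≤-antisym (mk _ cl) (ml _ ck)
connectivity-unique (inj₁ (k≤r , ck , _)) (inj₂ (_ , none)) = ⊥-elim (none _ k≤r ck)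
connectivity-unique (inj₂ (_ , none)) (inj₁ (l≤r , cl , _)) = ⊥-elim (none _ l≤r cl)
connectivity-unique (inj₂ (k≡ , _)) (inj₂ (l≡ , _)) = trans k≡ (sym l≡)

Word : ℕ → Set
Word = Vec Bool

record Code (r : ℕ) : Set where
  field
    member   : Word r → Bool
    nonempty : ∃[ w ] T (member w)

open Code public

infix 4 _∈ᶜ_

_∈ᶜ_ : ∀ {r} → Word r → Code r → Set
w ∈ᶜ C = T (member C w)

allWords : ∀ r → List (Word r)
allWords zero    = [] ∷ []
allWords (suc r) = cartesianProductWith _∷_ (false ∷ true ∷ []) (allWords r)

codewords : ∀ {r} → Code r → List (Word r)
codewords {r} C = filter (λ w → T? (member C w)) (allWords r)

size : ∀ {r} → Code r → ℕ
size C = length (codewords C)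

codeword : ∀ {r} (C : Code r) → Fin (size C) → Word r
codeword C = List.lookup (codewords C)

allWords-complete : ∀ {r} (w : Word r) → w ∈ˡ allWords r
allWords-complete []          = here refl
allWords-complete (false ∷ w) =
  ∈-cartesianProductWith⁺ _∷_ {xs = false ∷ true ∷ []} (here refl) (allWords-complete w)
allWords-complete (true ∷ w)  =
  ∈-cartesianProductWith⁺ _∷_ {xs = false ∷ true ∷ []} (there (here refl)) (allWords-complete w)

allWords-unique : ∀ r → Unique (allWords r)
allWords-unique zero    = [] ∷ []
allWords-unique (suc r) = cartesianProductWith⁺ _∷_ ∷-injective
  (((λ ()) ∷ []) ∷ [] ∷ []) (allWords-unique r)

-- By the next three facts codeword C is a bijection from Fin (size C) onto C, so
-- Matrix (size C) is ℝ^{C×C} with rows and columns indexed by codewords.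

∈-codewords⁺ : ∀ {r} (C : Code r) {w} → w ∈ᶜ C → w ∈ˡ codewords C
∈-codewords⁺ C {w} = ∈-filter⁺ (λ w → T? (member C w)) (allWords-complete w)

∈-codewords⁻ : ∀ {r} (C : Code r) {w} → w ∈ˡ codewords C → w ∈ᶜ C
∈-codewords⁻ {r} C w∈ =
  proj₂ (∈-filter⁻ (λ w → T? (member C w)) {xs = allWords r} w∈)

codewords-unique : ∀ {r} (C : Code r) → Unique (codewords C)
codewords-unique {r} C = filter⁺ (λ w → T? (member C w)) (allWords-unique r)

NonRedundant : ∀ {r} → Code r → Subset r → Set
NonRedundant {r} C I =
  Σ (∀ j → j ∈ I → Word r) λ c →
    (∀ j (j∈I : j ∈ I) → c j j∈I ∈ᶜ C) ×
    (∀ i j → i ∈ I → (j∈I : j ∈ I) →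
      (i ≡ j → lookup (c j j∈I) i ≡ true) × (i ≢ j → lookup (c j j∈I) i ≡ false))

HasNonRedundantSet : ∀ {r} → Code r → Pred ℕ 0ℓ
HasNonRedundantSet C k = ∃[ I ] (∣ I ∣ ≡ k × NonRedundant C I)

Separates : ∀ {r} → Subset r → Fin r → Word r → Set
Separates I j w = ∀ i → i ∈ I →
  (i ≡ j → lookup w i ≡ true) × (i ≢ j → lookup w i ≡ false)

separates? : ∀ {r} (I : Subset r) j → Decidable (Separates I j)
separates? I j w = Fin.all? λ i → i ∈? I →-dec
  ((i Fin.≟ j →-dec lookup w i ≟ᵇ true) ×-dec
   (¬? (i Fin.≟ j) →-dec lookup w i ≟ᵇ false))

separator? : ∀ {r} (C : Code r) I j → Dec (∃[ w ] (w ∈ᶜ C × Separates I j w))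
separator? C I j = map′
  (λ w → let (v , v∈ , s) = find w in v , ∈-codewords⁻ C v∈ , s)
  (λ (v , v∈C , s) → lose (∈-codewords⁺ C v∈C) s)
  (any? (separates? I j) (codewords C))

nonRedundant? : ∀ {r} (C : Code r) → Decidable (NonRedundant C)
nonRedundant? C I = map′
  (λ h → (λ j j∈I → proj₁ (h j j∈I))
       , (λ j j∈I → proj₁ (proj₂ (h j j∈I)))
       , (λ i j i∈I j∈I → proj₂ (proj₂ (h j j∈I)) i i∈I))
  (λ (c , c∈C , s) j j∈I → c j j∈I , c∈C j j∈I , λ i i∈I → s i j i∈I j∈I)
  (Fin.all? λ j → j ∈? I →-dec separator? C I j)

greatest : ∀ {P : Pred ℕ 0ℓ} → Decidable P → P 0 →
  ∀ b → (∀ m → P m → m ℕ.≤ b) → ∃ (IsGreatest P)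
greatest P? p₀ zero    ub = 0 , p₀ , ub
greatest {P} P? p₀ (suc b) ub with P? (suc b)
... | yes p = suc b , p , ub
... | no ¬p = greatest P? p₀ b λ m pm →
  ℕ.≤-pred (ℕ.≤∧≢⇒< (ub m pm) λ { refl → ¬p pm })

nrd : ∀ {r} (C : Code r) → ∃ (IsGreatest (HasNonRedundantSet C))
nrd {r} C = greatest
  (λ k → anySubset? λ I → (∣ I ∣ ℕ.≟ k) ×-dec nonRedundant? C I)
  ( Subset.⊥ , ∣⊥∣≡0 r
  , (λ _ j∈ → ⊥-elim (∉⊥ j∈)) , (λ _ j∈ → ⊥-elim (∉⊥ j∈)) , (λ _ _ i∈ → ⊥-elim (∉⊥ i∈)))
  r (λ { _ (I , refl , _) → ∣p∣≤n I })

NRD : ∀ {r} → Code r → ℕ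
NRD C = proj₁ (nrd C)

NRD-greatest : ∀ {r} (C : Code r) → IsGreatest (HasNonRedundantSet C) (NRD C)
NRD-greatest C = proj₂ (nrd C)

bit : Bool → ℝ
bit b = if b then 1ᴿ else 0ᴿ

≡⇒≃ : ∀ {x y} → x ≡ y → x ≃ y
≡⇒≃ {x} refl ε 0<ε = 0 , λ n _ →
  subst (ℚ._< ε) (sym (cong ℚ.∣_∣ (ℚ.+-inverseʳ (seq x n)))) 0<ε

diagonal-sym : ∀ {n} (d : Fin n → ℝ) p q → diagonal d p q ≡ diagonal d q p
diagonal-sym d p q with p Fin.≟ q | q Fin.≟ p
... | yes refl | yes _    = refl
... | yes refl | no p≢p   = ⊥-elim (p≢p refl)
... | no p≢q   | yes refl = ⊥-elim (p≢q refl)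
... | no _     | no _     = refl

sum-nonNeg : ∀ {n} (f : Fin n → ℝ) k → (∀ i → 0ℚ ℚ.≤ seq (f i) k) → 0ℚ ℚ.≤ seq (sum f) k
sum-nonNeg {zero}  f k h = ℚ.≤-refl
sum-nonNeg {suc n} f k h = ℚ.+-mono-≤ (h zero) (sum-nonNeg (f ∘ suc) k (h ∘ suc))

square-nonNeg : ∀ a → 0ℚ ℚ.≤ a ℚ.* a
square-nonNeg a with ℚ.≤-total 0ℚ a
... | inj₁ 0≤a = subst (ℚ._≤ a ℚ.* a) (ℚ.*-zeroʳ a)
                   (ℚ.*-monoˡ-≤-nonNeg a {{ℚ.nonNegative 0≤a}} 0≤a)
... | inj₂ a≤0 = subst (ℚ._≤ a ℚ.* a) (ℚ.*-zeroʳ a)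
                   (ℚ.*-monoˡ-≤-nonPos a {{ℚ.nonPositive a≤0}} a≤0)

a0b-nonNeg : ∀ a b → 0ℚ ℚ.≤ a ℚ.* 0ℚ ℚ.* b
a0b-nonNeg a b = ℚ.≤-reflexive (sym (trans (cong (ℚ._* b) (ℚ.*-zeroʳ a)) (ℚ.*-zeroˡ b)))

bit-diagonal-term : ∀ {n} (b : Fin n → Bool) (x : Fin n → ℝ) k p q →
  0ℚ ℚ.≤ seq (x p *ᴿ diagonal (bit ∘ b) p q *ᴿ x q) k
bit-diagonal-term b x k p q with p Fin.≟ q
... | no _ = a0b-nonNeg (seq (x p) k) (seq (x q) k)
... | yes refl with b p
...   | false = a0b-nonNeg (seq (x p) k) (seq (x p) k)
...   | true  = subst (λ a → 0ℚ ℚ.≤ a ℚ.* seq (x p) k) (sym (ℚ.*-identityʳ (seq (x p) k)))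
                  (square-nonNeg (seq (x p) k))

bit-diagonal-isPSD : ∀ {n} (b : Fin n → Bool) → IsPSD (diagonal (bit ∘ b))
bit-diagonal-isPSD b =
  (λ p q → ≡⇒≃ (diagonal-sym (bit ∘ b) p q)) ,
  (λ x ε 0<ε → 0 , λ k _ → ℚ.+-mono-≤
    (sum-nonNeg _ k λ p → sum-nonNeg _ k λ q → bit-diagonal-term b x k p q) (ℚ.<⇒≤ 0<ε))

codeMatrix : ∀ {r} (C : Code r) → Fin r → PSDMatrix (size C)
codeMatrix C i = record
  { matrix = diagonal λ c → bit (lookup (codeword C c) i)
  ; isPSD  = bit-diagonal-isPSD λ c → lookup (codeword C c) i
  }

{-# OPTIONS --safe #-}

-- Testing α C_i ⪯ Σ_{j ∈ T∖i} C_j for diagonal 0/1 matrices with 0 < α ≤ 1 amounts to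
-- comparing diagonal entries: it holds iff every codeword c with c_i = 1 has c_j = 1 for
-- some other j ∈ T, that is, iff no codeword separates i from T∖i.  So T is non-redundant
-- exactly when no i ∈ T satisfies the inequality.

module Submission where

open import Defs
open import Data.Bool.Base using (true; false; if_then_else_)
open import Data.Bool.Properties using (¬-not) renaming (_≟_ to _≟ᵇ_)
open import Data.Fin.Base using (Fin; zero; suc)
import Data.Fin.Properties as Fin
open import Data.Fin.Subset using (Subset; _∈_; _∉_; ∣_∣; _-_; ⁅_⁆)
open import Data.Fin.Subset.Properties
  using (_∈?_; ∣p∣≤n; p─q─q≡p─q; p─q⊆p; x∈p⇒∣p-x∣<∣p∣; x∈p∧x≢y⇒x∈p-y)
open import Data.List.Membership.Propositional.Properties using (∈-lookup)
open import Data.List.Relation.Unary.Any using (index)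
open import Data.List.Relation.Unary.Any.Properties using (lookup-index)
open import Data.Nat.Base as ℕ using (ℕ; zero; suc; _+_)
import Data.Nat.Properties as ℕ
open import Data.Product.Base using (∃-syntax; _×_; _,_; proj₁; proj₂)
open import Data.Rational.Base as ℚ using (0ℚ; 1ℚ; ½)
import Data.Rational.Properties as ℚ
open import Data.Rational.Solver using (module +-*-Solver)
open import Data.Sum.Base using (inj₁; inj₂)
open import Data.Vec.Base using (lookup)
open import Data.Vec.Properties using ([]=⇒lookup; lookup⇒[]=)
open import Function.Base using (_∘_; const)
open import Relation.Binary.PropositionalEquality
  using (_≡_; _≢_; refl; sym; trans; cong; cong₂; subst)
open import Relation.Nullary using (¬_; yes; no; does; contradiction)
open import Relation.Nullary.Decidable
  using (¬?; _×-dec_; _→-dec_; decidable-stable; dec-true; dec-false)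

-- Order on Cauchy reals.

pointwise⇒≃ : ∀ {x y} → (∀ k → seq x k ≡ seq y k) → x ≃ y
pointwise⇒≃ {x} {y} x≡y ε 0<ε = 0 , λ k _ → subst (ℚ._< ε)
  (sym (cong ℚ.∣_∣ (trans (cong (ℚ._- seq y k) (x≡y k)) (ℚ.+-inverseʳ (seq y k))))) 0<ε

pointwise⇒≤ : ∀ {x y} → (∀ k → seq x k ℚ.≤ seq y k) → x ≤ y
pointwise⇒≤ {x} {y} x≤y ε 0<ε = 0 , λ k _ →
  subst (ℚ._≤ seq y k ℚ.+ ε) (ℚ.+-identityʳ (seq x k)) (ℚ.+-mono-≤ (x≤y k) (ℚ.<⇒≤ 0<ε))

0≤-+ : ∀ {x y} → 0ᴿ ≤ x → 0ᴿ ≤ y → 0ᴿ ≤ x +ᴿ y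
0≤-+ {x} {y} 0≤x 0≤y ε 0<ε with 0≤x (½ ℚ.* ε) (0<½* 0<ε) | 0≤y (½ ℚ.* ε) (0<½* 0<ε)
... | M , hx | N , hy = M ℕ.⊔ N , λ n n≥ → begin
    0ℚ ℚ.+ 0ℚ
      ≤⟨ ℚ.+-mono-≤ (hx n (ℕ.m⊔n≤o⇒m≤o M N n≥)) (hy n (ℕ.m⊔n≤o⇒n≤o M N n≥)) ⟩
    (seq x n ℚ.+ ½ ℚ.* ε) ℚ.+ (seq y n ℚ.+ ½ ℚ.* ε)
      ≡⟨ solve 3 (λ a b c → (a :+ c) :+ (b :+ c) := (a :+ b) :+ (c :+ c)) refl
           (seq x n) (seq y n) (½ ℚ.* ε) ⟩
    (seq x n ℚ.+ seq y n) ℚ.+ (½ ℚ.* ε ℚ.+ ½ ℚ.* ε)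
      ≡⟨ cong ((seq x n ℚ.+ seq y n) ℚ.+_) (½+½ ε) ⟩
    (seq x n ℚ.+ seq y n) ℚ.+ ε ∎
  where open ℚ.≤-Reasoning
        open +-*-Solver

0≤-sum : ∀ {n} (f : Fin n → ℝ) → (∀ i → 0ᴿ ≤ f i) → 0ᴿ ≤ sum f
0≤-sum {zero}  f h = pointwise⇒≤ {0ᴿ} {0ᴿ} λ _ → ℚ.≤-refl
0≤-sum {suc n} f h = 0≤-+ {f zero} {sum (f ∘ suc)} (h zero) (0≤-sum (f ∘ suc) (h ∘ suc))

∣p∣≤b⇒p*p≤b*b : ∀ {p b} → ℚ.∣ p ∣ ℚ.≤ b → p ℚ.* p ℚ.≤ b ℚ.* b
∣p∣≤b⇒p*p≤b*b {p} {b} ∣p∣≤b = begin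
    p ℚ.* p               ≡⟨ sym (ℚ.0≤p⇒∣p∣≡p (square-nonNeg p)) ⟩
    ℚ.∣ p ℚ.* p ∣         ≡⟨ ℚ.∣p*q∣≡∣p∣*∣q∣ p p ⟩
    ℚ.∣ p ∣ ℚ.* ℚ.∣ p ∣   ≤⟨ ℚ.*-monoʳ-≤-nonNeg ℚ.∣ p ∣ {{ℚ.∣-∣-nonNeg p}} ∣p∣≤b ⟩
    b ℚ.* ℚ.∣ p ∣         ≤⟨ ℚ.*-monoˡ-≤-nonNeg b
                               {{ℚ.nonNegative (ℚ.≤-trans (ℚ.0≤∣p∣ p) ∣p∣≤b)}} ∣p∣≤b ⟩
    b ℚ.* b ∎
  where open ℚ.≤-Reasoning

-- The terms of `m` may be negative, but eventually exceed any `- δ`. Multiplying by the square of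
-- `x` turns this error into at most `B * B * δ`, where `B` eventually bounds the terms of `x`; `δ`
-- is chosen to make that product half of `ε`.
0≤-conjugate : ∀ {m} x → 0ᴿ ≤ m → 0ᴿ ≤ x *ᴿ m *ᴿ x
0≤-conjugate {m} x 0≤m ε 0<ε =
  let (B , 0<B , M , ∣x∣≤B) = eventually-bounded {seq x} (cauchy x)
      B⁺                    = ℚ.positive 0<B
      0<B²                  = ℚ.positive⁻¹ (B ℚ.* B) {{ℚ.pos*pos⇒pos B {{B⁺}} B {{B⁺}}}}
      (δ , 0<δ , B²δ≡)      = small-multiple {B ℚ.* B} {ε} 0<B² 0<ε
      (N , 0≤m+δ)           = 0≤m δ 0<δ
  in M ℕ.⊔ N , λ n n≥ →
     let x²  = seq x n ℚ.* seq x n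
         xmx = seq x n ℚ.* seq m n ℚ.* seq x n
     in begin
     0ℚ
       ≡⟨ sym (ℚ.*-zeroʳ x²) ⟩
     x² ℚ.* 0ℚ
       ≤⟨ ℚ.*-monoˡ-≤-nonNeg x² {{ℚ.nonNegative (square-nonNeg (seq x n))}}
            (0≤m+δ n (ℕ.m⊔n≤o⇒n≤o M N n≥)) ⟩
     x² ℚ.* (seq m n ℚ.+ δ)
       ≡⟨ solve 3 (λ a b c → a :* a :* (b :+ c) := a :* b :* a :+ a :* a :* c) refl
            (seq x n) (seq m n) δ ⟩
     xmx ℚ.+ x² ℚ.* δ
       ≤⟨ ℚ.+-monoʳ-≤ xmx (ℚ.*-monoʳ-≤-nonNeg δ {{ℚ.nonNegative (ℚ.<⇒≤ 0<δ)}}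
            (∣p∣≤b⇒p*p≤b*b {seq x n} {B} (∣x∣≤B n (ℕ.m⊔n≤o⇒m≤o M N n≥)))) ⟩
     xmx ℚ.+ B ℚ.* B ℚ.* δ
       ≡⟨ cong (xmx ℚ.+_) B²δ≡ ⟩
     xmx ℚ.+ ½ ℚ.* ε
       ≤⟨ ℚ.+-monoʳ-≤ xmx ½ε≤ε ⟩
     xmx ℚ.+ ε ∎
  where
    open ℚ.≤-Reasoning
    open +-*-Solver
    ½ε≤ε : ½ ℚ.* ε ℚ.≤ ε
    ½ε≤ε = subst (½ ℚ.* ε ℚ.≤_) (½+½ ε)
      (subst (ℚ._≤ ½ ℚ.* ε ℚ.+ ½ ℚ.* ε) (ℚ.+-identityʳ (½ ℚ.* ε))
        (ℚ.+-monoʳ-≤ (½ ℚ.* ε) (ℚ.<⇒≤ (0<½* 0<ε))))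

-- Finite sums evaluated at a fixed index of the sequences.

seq-sum-zero : ∀ {n} (f : Fin n → ℝ) k → (∀ i → seq (f i) k ≡ 0ℚ) → seq (sum f) k ≡ 0ℚ
seq-sum-zero {zero}  f k h = refl
seq-sum-zero {suc n} f k h = cong₂ ℚ._+_ (h zero) (seq-sum-zero (f ∘ suc) k (h ∘ suc))

seq-sum-single : ∀ {n} (f : Fin n → ℝ) k j → (∀ i → i ≢ j → seq (f i) k ≡ 0ℚ) →
                 seq (sum f) k ≡ seq (f j) k
seq-sum-single f k zero    h = trans
  (cong (seq (f zero) k ℚ.+_) (seq-sum-zero (f ∘ suc) k λ i → h (suc i) λ ()))
  (ℚ.+-identityʳ _)
seq-sum-single f k (suc j) h = trans
  (cong₂ ℚ._+_ (h zero λ ())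
    (seq-sum-single (f ∘ suc) k j λ i i≢j → h (suc i) (i≢j ∘ Fin.suc-injective)))
  (ℚ.+-identityˡ _)

seq-term≤sum : ∀ {n} (f : Fin n → ℝ) k → (∀ i → 0ℚ ℚ.≤ seq (f i) k) →
               ∀ j → seq (f j) k ℚ.≤ seq (sum f) k
seq-term≤sum f k h zero    = subst (ℚ._≤ seq (sum f) k) (ℚ.+-identityʳ _)
  (ℚ.+-monoʳ-≤ (seq (f zero) k) (sum-nonNeg (f ∘ suc) k (h ∘ suc)))
seq-term≤sum f k h (suc j) = subst (ℚ._≤ seq (sum f) k) (ℚ.+-identityˡ _)
  (ℚ.+-mono-≤ (h zero) (seq-term≤sum (f ∘ suc) k (h ∘ suc) j))

-- Diagonal matrices and positive semidefiniteness.

IsDiagonal : ∀ {n} → Matrix n → Set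
IsDiagonal M = ∀ p q → p ≢ q → ∀ k → seq (M p q) k ≡ 0ℚ

-- Every term of the quadratic form is nonnegative by itself: off the diagonal it vanishes at each
-- index, and on the diagonal it is a nonnegative entry multiplied on both sides by the same real.
diagonal-nonNeg⇒PSD : ∀ {n} (M : Matrix n) → IsDiagonal M → (∀ p → 0ᴿ ≤ M p p) → IsPSD M
diagonal-nonNeg⇒PSD M off 0≤M = symmetric , λ x → 0≤-sum _ λ p → 0≤-sum _ (term x p)
  where
    symmetric : ∀ p q → M p q ≃ M q p
    symmetric p q with p Fin.≟ q
    ... | yes refl = pointwise⇒≃ {M p p} {M p p} λ _ → refl
    ... | no p≢q   = pointwise⇒≃ {M p q} {M q p} λ k →
                       trans (off p q p≢q k) (sym (off q p (p≢q ∘ sym) k))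
    term : ∀ x p q → 0ᴿ ≤ x p *ᴿ M p q *ᴿ x q
    term x p q with p Fin.≟ q
    ... | yes refl = 0≤-conjugate {M p p} (x p) (0≤M p)
    ... | no p≢q   = pointwise⇒≤ {0ᴿ} {x p *ᴿ M p q *ᴿ x q} λ k →
      subst (λ m → 0ℚ ℚ.≤ seq (x p) k ℚ.* m ℚ.* seq (x q) k) (sym (off p q p≢q k))
        (a0b-nonNeg (seq (x p) k) (seq (x q) k))

-- The standard basis vector of `p`.
indicator : ∀ {n} → Fin n → Fin n → ℝ
indicator p q = bit (does (q Fin.≟ p))

indicator-same : ∀ {n} (p : Fin n) k → seq (indicator p p) k ≡ 1ℚ
indicator-same p k = cong (λ b → seq (bit b) k) (dec-true (p Fin.≟ p) refl)

indicator-other : ∀ {n} {p q : Fin n} k → q ≢ p → seq (indicator p q) k ≡ 0ℚ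
indicator-other {p = p} {q} k q≢p = cong (λ b → seq (bit b) k) (dec-false (q Fin.≟ p) q≢p)

-- Only the summand at row and column `p` survives. The equality holds at every index `k`, so a
-- bound on the form carries over to the entry with the same threshold.
quadraticForm-indicator : ∀ {n} (M : Matrix n) p k →
  seq (quadraticForm M (indicator p)) k ≡ seq (M p p) k
quadraticForm-indicator M p k = trans (seq-sum-single _ k p rows)
  (trans (seq-sum-single _ k p columns) corner)
  where
    columns : ∀ q → q ≢ p → seq (indicator p p *ᴿ M p q *ᴿ indicator p q) k ≡ 0ℚ
    columns q q≢p = trans
      (cong (seq (indicator p p *ᴿ M p q) k ℚ.*_) (indicator-other k q≢p))
      (ℚ.*-zeroʳ (seq (indicator p p *ᴿ M p q) k))
    rows : ∀ p′ → p′ ≢ p → seq (sum λ q → indicator p p′ *ᴿ M p′ q *ᴿ indicator p q) k ≡ 0ℚ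
    rows p′ p′≢p = seq-sum-zero _ k λ q → trans
      (cong (λ a → a ℚ.* seq (M p′ q) k ℚ.* seq (indicator p q) k) (indicator-other k p′≢p))
      (trans (cong (ℚ._* seq (indicator p q) k) (ℚ.*-zeroˡ (seq (M p′ q) k)))
             (ℚ.*-zeroˡ (seq (indicator p q) k)))
    corner : seq (indicator p p *ᴿ M p p *ᴿ indicator p p) k ≡ seq (M p p) k
    corner = trans
      (cong₂ (λ a b → a ℚ.* seq (M p p) k ℚ.* b) (indicator-same p k) (indicator-same p k))
      (trans (ℚ.*-identityʳ _) (ℚ.*-identityˡ _))

PSD⇒diagonal-nonNeg : ∀ {n} (M : Matrix n) → IsPSD M → ∀ p → 0ᴿ ≤ M p p
PSD⇒diagonal-nonNeg M (_ , h) p ε 0<ε with h (indicator p) ε 0<ε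
... | N , hN = N , λ k k≥ →
  subst (λ a → 0ℚ ℚ.≤ a ℚ.+ ε) (quadraticForm-indicator M p k) (hN k k≥)

-- If `x` were still present, removing it again would strictly lower the cardinality, yet a second
-- removal changes nothing.
x∉p-x : ∀ {n} (p : Subset n) x → x ∉ p - x
x∉p-x p x x∈ = ℕ.<-irrefl (cong ∣_∣ (p─q─q≡p─q p ⁅ x ⁆)) (x∈p⇒∣p-x∣<∣p∣ x∈)

diagonal-same : ∀ {n} (d : Fin n → ℝ) p → diagonal d p p ≡ d p
diagonal-same d p = cong (λ b → if b then d p else 0ᴿ) (dec-true (p Fin.≟ p) refl)

diagonal-other : ∀ {n} (d : Fin n → ℝ) {p q} → p ≢ q → diagonal d p q ≡ 0ᴿ
diagonal-other d {p} {q} p≢q = cong (λ b → if b then d p else 0ᴿ) (dec-false (p Fin.≟ q) p≢q)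

-- Code matrices, domination and separation.

module _ {r} (C : Code r) where

  entry : ∀ i p → matrix (codeMatrix C i) p p ≡ bit (lookup (codeword C p) i)
  entry i p = diagonal-same (λ c → bit (lookup (codeword C c) i)) p

  offDiagonal : ∀ i {p q} → p ≢ q → matrix (codeMatrix C i) p q ≡ 0ᴿ
  offDiagonal i = diagonal-other (λ c → bit (lookup (codeword C c) i))

  if-nonNeg : ∀ b i p k → 0ℚ ℚ.≤ seq (if b then matrix (codeMatrix C i) p p else 0ᴿ) k
  if-nonNeg false i p k = ℚ.≤-refl
  if-nonNeg true  i p k rewrite entry i p with lookup (codeword C p) i
  ... | false = ℚ.≤-refl
  ... | true  = ℚ.<⇒≤ (ℚ.positive⁻¹ 1ℚ)

  -- Positive semidefiniteness of this matrix is, by unfolding `_⪯_`, the inequality in the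
  -- connectivity condition.
  difference : ℝ → Subset r → Fin r → Matrix (size C)
  difference α T i p q =
    ∑[ T - i ] (matrix ∘ codeMatrix C) p q -ᴿ (α · matrix (codeMatrix C i)) p q

  difference-isDiagonal : ∀ α T i → IsDiagonal (difference α T i)
  difference-isDiagonal α T i p q p≢q k = cong₂ ℚ._-_
    (seq-sum-zero _ k λ j → zeros (lookup (T - i) j) j)
    (trans (cong (λ x → seq α k ℚ.* seq x k) (offDiagonal i p≢q)) (ℚ.*-zeroʳ (seq α k)))
    where
      zeros : ∀ b j → seq (if b then matrix (codeMatrix C j) p q else 0ᴿ) k ≡ 0ℚ
      zeros false j = refl
      zeros true  j = cong (λ x → seq x k) (offDiagonal j p≢q)

  -- The difference is diagonal, so its entries can be checked one codeword at a time. If bit `i` is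
  -- 0, nothing is subtracted from a sum of nonnegative terms; if it is 1, the dominating `j`
  -- contributes 1, which is at least `α`.
  dominated⇒⪯ : ∀ {α T i} → α ≤ 1ᴿ →
    (∀ p → lookup (codeword C p) i ≡ true →
       ∃[ j ] (j ∈ T × j ≢ i × lookup (codeword C p) j ≡ true)) →
    (α · matrix (codeMatrix C i)) ⪯ ∑[ T - i ] (matrix ∘ codeMatrix C)
  dominated⇒⪯ {α} {T} {i} α≤1 dom =
    diagonal-nonNeg⇒PSD (difference α T i) (difference-isDiagonal α T i)
      (λ p → nonNeg p _ refl)
    where
      open ℚ.≤-Reasoning
      open +-*-Solver
      others : Fin (size C) → ℝ
      others p = ∑[ T - i ] (matrix ∘ codeMatrix C) p p
      terms-nonNeg : ∀ p k j →
        0ℚ ℚ.≤ seq (if lookup (T - i) j then matrix (codeMatrix C j) p p else 0ᴿ) k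
      terms-nonNeg p k j = if-nonNeg (lookup (T - i) j) j p k
      nonNeg : ∀ p b → lookup (codeword C p) i ≡ b → 0ᴿ ≤ difference α T i p p
      nonNeg p false eq ε 0<ε = 0 , λ k _ → begin
        0ℚ
          ≤⟨ ℚ.+-mono-≤ (sum-nonNeg _ k (terms-nonNeg p k)) (ℚ.<⇒≤ 0<ε) ⟩
        seq (others p) k ℚ.+ ε
          ≡⟨ solve 3 (λ s a e → s :+ e := (s :- a :* con 0ℚ) :+ e) refl
               (seq (others p) k) (seq α k) ε ⟩
        (seq (others p) k ℚ.- seq α k ℚ.* 0ℚ) ℚ.+ ε
          ≡⟨ cong (λ x → (seq (others p) k ℚ.- seq α k ℚ.* seq x k) ℚ.+ ε)
               (sym (trans (entry i p) (cong bit eq))) ⟩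
        seq (difference α T i p p) k ℚ.+ ε ∎
      -- `α ≤ 1ᴿ` bounds the terms of `α` only by `1 + ε`; the tolerance `ε` in the goal absorbs
      -- this excess.
      nonNeg p true eq ε 0<ε with dom p eq | α≤1 ε 0<ε
      ... | j , j∈T , j≢i , cj≡1 | N , α≤1+ε = N , λ k k≥ → begin
        0ℚ
          ≡⟨ sym (ℚ.+-inverseʳ (seq α k)) ⟩
        seq α k ℚ.- seq α k
          ≤⟨ ℚ.+-monoˡ-≤ (ℚ.- seq α k) (α≤1+ε k k≥) ⟩
        (1ℚ ℚ.+ ε) ℚ.- seq α k
          ≡⟨ solve 2 (λ a e → (con 1ℚ :+ e) :- a := (con 1ℚ :- a :* con 1ℚ) :+ e) refl
               (seq α k) ε ⟩
        (1ℚ ℚ.- seq α k ℚ.* 1ℚ) ℚ.+ ε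
          ≤⟨ ℚ.+-monoˡ-≤ ε (ℚ.+-monoˡ-≤ (ℚ.- (seq α k ℚ.* 1ℚ)) (1≤others k)) ⟩
        (seq (others p) k ℚ.- seq α k ℚ.* 1ℚ) ℚ.+ ε
          ≡⟨ cong (λ x → (seq (others p) k ℚ.- seq α k ℚ.* seq x k) ℚ.+ ε)
               (sym (trans (entry i p) (cong bit eq))) ⟩
        seq (difference α T i p p) k ℚ.+ ε ∎
        where
          1≤others : ∀ k → 1ℚ ℚ.≤ seq (others p) k
          1≤others k = subst (ℚ._≤ seq (others p) k)
            (trans
              (cong (λ b → seq (if b then matrix (codeMatrix C j) p p else 0ᴿ) k)
                ([]=⇒lookup (x∈p∧x≢y⇒x∈p-y j∈T j≢i)))
              (cong (λ x → seq x k) (trans (entry j p) (cong bit cj≡1))))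
            (seq-term≤sum _ k (terms-nonNeg p k) j)

  -- At the separating codeword all bits from `T - i` vanish, so the diagonal entry of the
  -- difference is `- α`, which is negative.
  separated⇒¬⪯ : ∀ {α T i} p → 0ᴿ < α → i ∈ T → Separates T i (codeword C p) →
    ¬ (α · matrix (codeMatrix C i)) ⪯ ∑[ T - i ] (matrix ∘ codeMatrix C)
  separated⇒¬⪯ {α} {T} {i} p (ε , 0<ε , M , ε≤α) i∈T sep psd =
    -- Here `ε` is the gap witnessing `0ᴿ < α`. Nonnegativity with tolerance half of `ε` bounds `α`
    -- above by that half at the common index `k`, against `ε ≤ α` there.
    let (N , 0≤d+½ε) = PSD⇒diagonal-nonNeg (difference α T i) psd p (½ ℚ.* ε) (0<½* 0<ε)
        k            = M ℕ.⊔ N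
        ε≤½ε         = begin
          ε
            ≡⟨ solve 1 (λ e → e := con 0ℚ :+ (con 0ℚ :+ e)) refl ε ⟩
          0ℚ ℚ.+ (0ℚ ℚ.+ ε)
            ≤⟨ ℚ.+-mono-≤ (0≤d+½ε k (ℕ.m≤n⊔m M N)) (ε≤α k (ℕ.m≤m⊔n M N)) ⟩
          (seq (difference α T i p p) k ℚ.+ ½ ℚ.* ε) ℚ.+ seq α k
            ≡⟨ cong (λ d → (d ℚ.+ ½ ℚ.* ε) ℚ.+ seq α k) (entry≡-α k) ⟩
          ((0ℚ ℚ.- seq α k ℚ.* 1ℚ) ℚ.+ ½ ℚ.* ε) ℚ.+ seq α k
            ≡⟨ solve 2 (λ h a → ((con 0ℚ :- a :* con 1ℚ) :+ h) :+ a := h) refl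
                 (½ ℚ.* ε) (seq α k) ⟩
          ½ ℚ.* ε ∎
        ε<ε          = begin-strict
          ε                           ≡⟨ sym (ℚ.+-identityʳ ε) ⟩
          ε ℚ.+ 0ℚ                    <⟨ ℚ.+-mono-≤-< ε≤½ε (0<½* 0<ε) ⟩
          ½ ℚ.* ε ℚ.+ ½ ℚ.* ε         ≡⟨ ½+½ ε ⟩
          ε ∎
    in ℚ.<-irrefl refl ε<ε
    where
      open ℚ.≤-Reasoning
      open +-*-Solver
      zeros : ∀ k j → seq (if lookup (T - i) j then matrix (codeMatrix C j) p p else 0ᴿ) k ≡ 0ℚ
      zeros k j with lookup (T - i) j in eq
      ... | false = refl
      ... | true  = cong (λ x → seq x k) (trans (entry j p) (cong bit
        (proj₂ (sep j (p─q⊆p T ⁅ i ⁆ j∈T-i)) λ { refl → x∉p-x T i j∈T-i })))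
        where
          j∈T-i : j ∈ T - i
          j∈T-i = lookup⇒[]= j (T - i) eq
      entry≡-α : ∀ k → seq (difference α T i p p) k ≡ 0ℚ ℚ.- seq α k ℚ.* 1ℚ
      entry≡-α k = cong₂ (λ s x → s ℚ.- seq α k ℚ.* seq x k)
        (seq-sum-zero _ k (zeros k))
        (trans (entry i p) (cong bit (proj₁ (sep i i∈T) refl)))

  -- Having a separator is decidable by searching the finite code, so failure of non-redundancy
  -- yields an explicit `i` without one. A codeword with bit `i` set and no dominator would be such
  -- a separator.
  redundant⇒dominated : ∀ {T} → ¬ NonRedundant C T →
    ∃[ i ] (i ∈ T × (∀ p → lookup (codeword C p) i ≡ true →
      ∃[ j ] (j ∈ T × j ≢ i × lookup (codeword C p) j ≡ true)))
  redundant⇒dominated {T} ¬nr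
    with Fin.¬∀⟶∃¬ r _ (λ i → i ∈? T →-dec separator? C T i)
           (λ h → ¬nr ( (λ i i∈T → proj₁ (h i i∈T))
                      , (λ i i∈T → proj₁ (proj₂ (h i i∈T)))
                      , (λ i j i∈T j∈T → proj₂ (proj₂ (h j j∈T)) i i∈T)))
  ... | i , ¬sep = i
      -- Outside `T` the failing implication would hold vacuously.
      , decidable-stable (i ∈? T) (λ i∉T → ¬sep λ i∈T → contradiction i∈T i∉T)
      , dominator
    where
      dominator : ∀ p → lookup (codeword C p) i ≡ true →
        ∃[ j ] (j ∈ T × j ≢ i × lookup (codeword C p) j ≡ true)
      dominator p ci≡1
        with Fin.any? (λ j → j ∈? T ×-dec ¬? (j Fin.≟ i) ×-dec (lookup (codeword C p) j ≟ᵇ true))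
      ... | yes d = d
      ... | no ¬d = contradiction
        (const (codeword C p , ∈-codewords⁻ C (∈-lookup p) , λ j j∈T →
          (λ { refl → ci≡1 }) , λ j≢i → ¬-not λ cj≡1 → ¬d (j , j∈T , j≢i , cj≡1)))
        ¬sep

  -- Bounds on the connectivity parameter.

  connectedFrom-NRD+1 : ∀ {α} → α ≤ 1ᴿ → ConnectedFrom α (codeMatrix C) (NRD C + 1)
  connectedFrom-NRD+1 α≤1 T NRD<∣T∣ =
    -- A non-redundant `T` of this size would contradict the maximality of `NRD C`.
    let (i , i∈T , dom) = redundant⇒dominated λ nr → ℕ.<⇒≱
          (subst (ℕ._≤ ∣ T ∣) (ℕ.+-comm (NRD C) 1) NRD<∣T∣)
          (proj₂ (NRD-greatest C) ∣ T ∣ (T , refl , nr))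
    in i , i∈T , dominated⇒⪯ α≤1 dom

  -- A maximum non-redundant set is large enough to be tested, but each of its indices is separated
  -- by its own codeword.
  ¬connectedFrom≤NRD : ∀ {α m} → 0ᴿ < α → m ℕ.≤ NRD C → ¬ ConnectedFrom α (codeMatrix C) m
  ¬connectedFrom≤NRD {α} 0<α m≤NRD conn =
    let (I , ∣I∣≡NRD , c , c∈C , sep) = proj₁ (NRD-greatest C)
        (i , i∈I , psd) = conn I (subst (_ ℕ.≤_) (sym ∣I∣≡NRD) m≤NRD)
        cᵢ∈             = ∈-codewords⁺ C (c∈C i i∈I)
    -- The position of the separating word in the list of codewords is the matrix index at which the
    -- inequality fails.
    in separated⇒¬⪯ {T = I} (index cᵢ∈) 0<α i∈I
         (subst (Separates I i) (lookup-index cᵢ∈) λ j j∈I → sep j i j∈I i∈I) psd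

NRD≤r : ∀ {r} (C : Code r) → NRD C ℕ.≤ r
NRD≤r C with proj₁ (NRD-greatest C)
... | I , ∣I∣≡NRD , _ = subst (ℕ._≤ _) ∣I∣≡NRD (∣p∣≤n I)

lemma1p10 : ∀ (r : ℕ) (C : Code r) (α : ℝ) → 0ᴿ < α → α ≤ 1ᴿ → ConnectivityIs α (codeMatrix C) (NRD C + 1)
lemma1p10 r C α 0<α α≤1 with ℕ.m≤n⇒m<n∨m≡n (NRD≤r C)
... | inj₁ NRD<r = inj₁
  ( subst (ℕ._≤ r) (ℕ.+-comm 1 (NRD C)) NRD<r
  , connectedFrom-NRD+1 C α≤1
  , λ m conn → ℕ.≮⇒≥ λ m<NRD+1 → ¬connectedFrom≤NRD C 0<α
      (ℕ.≤-pred (subst (m ℕ.<_) (ℕ.+-comm (NRD C) 1) m<NRD+1)) conn)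
-- All `r` indices together are non-redundant, so no threshold up to `r` works and the default value
-- `r + 1` applies.
... | inj₂ NRD≡r = inj₂
  ( cong (_+ 1) NRD≡r
  , λ m m≤r → ¬connectedFrom≤NRD C 0<α (subst (m ℕ.≤_) (sym NRD≡r) m≤r))
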